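{- The generating functions of the numbers of brick-wall lattice paths of the first and second type for rectangles of width $w=4$ are, as formal power series, $$\sum_{l=1}^{\infty}\mathcal B^{(1)}_{l,4}\,z^l=\frac{4z+6z^2}{1-3z^2},\qquad \sum_{l=1}^{\infty}\mathcal B^{(2)}_{l,4}\,z^l=\frac{4z+8z^2}{1-3z^2}.$$
   Context: A point $(a,b)\in\mathbf Z\times\mathbf Z$ is even (odd) if $|a|+|b|$ is even (odd). A brick-wall lattice path of the first type is a finite sequence of points of $\mathbf Z\times\mathbf Z$ in which each consecutive step is either the horizontal step $(1,0)$ (allowed from any point), or the step $(0,1)$ taken from an even point, or the step $(0,-1)$ taken from an odd point. A brick-wall lattice path of the second type is defined in the same way with the steps $(1,0)$ from any point, $(0,1)$ from an odd point, $(0,-1)$ from an even point. Paths visit no point more than once; the empty path (a single point) is allowed. Let $\mathcal R=[0,l-1]\times[0,w-1]$, here with $w=4$. For $t\in\{1,2\}$, $\mathcal B^{(t)}_{l,w}$ is the number of brick-wall lattice paths of type $t$ (type 1 = first, type 2 = second) starting at some point $(0,\alpha)$ and ending at some point $(l-1,\beta)$, with $\alpha,\beta\in\{0,\dots,w-1\}$, staying inside $\mathcal R$ and using no vertical step along the left side $x=0$ (vertical steps along the right side $x=l-1$ are allowed when $l\ge2$). For $l=1$ the rectangle is a degenerate vertical segment and only the $w$ empty paths are counted. -}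

module Defs where

open import Data.Bool.Base using (if_then_else_)
open import Data.Empty using (⊥-elim)
open import Data.Integer.Base as ℤ using (ℤ; +_; 0ℤ; 1ℤ; -1ℤ; ∣_∣)
import Data.Integer.Properties as ℤ
open import Data.Integer.Tactic.RingSolver using (solve-∀)
open import Data.List.Base using (List; []; _∷_; _++_; length; filter; upTo; cartesianProductWith)
open import Data.List.NonEmpty.Base using (List⁺; _∷_; toList; head; last)
open import Data.List.Properties using (length-++; ∷-injective)
open import Data.List.Membership.Propositional using (_∈_)
open import Data.List.Membership.Propositional.Properties
  using (∈-∃++; ∈-++⁺ˡ; ∈-++⁺ʳ; ∈-++⁻; ∈-cartesianProductWith⁺; ∈-cartesianProductWith⁻; ∈-filter⁺; ∈-filter⁻; ∈-upTo⁺)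
open import Data.List.Relation.Unary.All as All using (All; []; _∷_; all?)
open import Data.List.Relation.Unary.AllPairs using ([]; _∷_)
open import Data.List.Relation.Unary.Any using (here; there)
open import Data.List.Relation.Unary.Linked using (Linked; linked?)
open import Data.List.Relation.Unary.Unique.Propositional using (Unique)
import Data.List.Relation.Unary.Unique.Propositional.Properties as Unique
import Data.List.Relation.Unary.Unique.DecPropositional as DecUnique
open import Data.Nat.Base as ℕ using (ℕ; zero; suc; z≤n; s≤s)
open import Data.Nat.Divisibility using (_∣_; _∣?_)
import Data.Nat.Properties as ℕ
open import Data.Product.Base using (_×_; _,_; proj₁; proj₂)
open import Data.Product.Properties using (≡-dec)
open import Data.Sum.Base using (_⊎_; inj₁; inj₂)
open import Function.Base using (_∘_)
open import Function.Bundles using (_⇔_; mk⇔)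
open import Relation.Binary.Core using (Rel)
open import Relation.Binary.Definitions using () renaming (Decidable to Decidable₂)
open import Relation.Binary.PropositionalEquality
open import Relation.Nullary using (¬_; ¬?; _×-dec_; _⊎-dec_)
open import Relation.Unary using (Pred; Decidable)
open import Level using (0ℓ)

------------------------------------------------------------------------
-- Brick-wall lattice paths

Point : Set
Point = ℤ × ℤ

_≟ᴾ_ : Decidable₂ (_≡_ {A = Point})
_≟ᴾ_ = ≡-dec ℤ._≟_ ℤ._≟_

Even Odd : Pred Point 0ℓ
Even (a , b) = 2 ∣ (∣ a ∣ ℕ.+ ∣ b ∣)
Odd p        = ¬ Even p

even? : Decidable Even
even? (a , b) = 2 ∣? (∣ a ∣ ℕ.+ ∣ b ∣)

odd? : Decidable Odd
odd? p = ¬? (even? p)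

infixl 6 _+ᴾ_
_+ᴾ_ : Point → Point → Point
(a , b) +ᴾ (c , d) = (a ℤ.+ c , b ℤ.+ d)

data PathType : Set where
  first second : PathType

Step : PathType → Rel Point 0ℓ
Step first p q =
    q ≡ p +ᴾ (1ℤ , 0ℤ)
  ⊎ Even p × q ≡ p +ᴾ (0ℤ , 1ℤ)
  ⊎ Odd  p × q ≡ p +ᴾ (0ℤ , -1ℤ)
Step second p q =
    q ≡ p +ᴾ (1ℤ , 0ℤ)
  ⊎ Odd  p × q ≡ p +ᴾ (0ℤ , 1ℤ)
  ⊎ Even p × q ≡ p +ᴾ (0ℤ , -1ℤ)

IsBrickWallPath : PathType → Pred (List⁺ Point) 0ℓ
IsBrickWallPath t ps = Linked (Step t) (toList ps) × Unique (toList ps)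

InRectangle : (l w : ℕ) → Pred Point 0ℓ
InRectangle l w (a , b) =
    (0ℤ ℤ.≤ a × a ℤ.≤ + l ℤ.- 1ℤ)
  × (0ℤ ℤ.≤ b × b ℤ.≤ + w ℤ.- 1ℤ)

-- For consecutive points p, q of a path: the step from p to q is not a
-- vertical one inside the line x = 0.
NotAlongLeftSide : Rel Point 0ℓ
NotAlongLeftSide p q = ¬ (proj₁ p ≡ 0ℤ × proj₁ q ≡ 0ℤ)

-- The end points are (0 , α) and (l - 1 , β) with 0 ≤ α , β ≤ w - 1; the
-- bounds on α and β are part of the confinement to the rectangle.
IsCrossing : PathType → (l w : ℕ) → Pred (List⁺ Point) 0ℓ
IsCrossing t l w ps =
    IsBrickWallPath t ps
  × All (InRectangle l w) (toList ps)
  × proj₁ (head ps) ≡ 0ℤ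
  × proj₁ (last ps) ≡ + l ℤ.- 1ℤ
  × Linked NotAlongLeftSide (toList ps)

------------------------------------------------------------------------
-- Decidability

step? : ∀ t → Decidable₂ (Step t)
step? first p q =
  (q ≟ᴾ _) ⊎-dec (even? p ×-dec (q ≟ᴾ _)) ⊎-dec (odd? p ×-dec (q ≟ᴾ _))
step? second p q =
  (q ≟ᴾ _) ⊎-dec (odd? p ×-dec (q ≟ᴾ _)) ⊎-dec (even? p ×-dec (q ≟ᴾ _))

inRectangle? : ∀ l w → Decidable (InRectangle l w)
inRectangle? l w (a , b) =
        ((0ℤ ℤ.≤? a) ×-dec (a ℤ.≤? + l ℤ.- 1ℤ))
  ×-dec ((0ℤ ℤ.≤? b) ×-dec (b ℤ.≤? + w ℤ.- 1ℤ))

isCrossing? : ∀ t l w → Decidable (IsCrossing t l w)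
isCrossing? t l w ps =
        (linked? (step? t) (toList ps) ×-dec DecUnique.unique? _≟ᴾ_ (toList ps))
  ×-dec all? (inRectangle? l w) (toList ps)
  ×-dec (proj₁ (head ps) ℤ.≟ 0ℤ)
  ×-dec (proj₁ (last ps) ℤ.≟ + l ℤ.- 1ℤ)
  ×-dec linked? (λ p q → ¬? ((proj₁ p ℤ.≟ 0ℤ) ×-dec (proj₁ q ℤ.≟ 0ℤ))) (toList ps)

------------------------------------------------------------------------
-- Counting.  A path without repeated points inside the rectangle is at
-- most as long as the rectangle has points, so all crossings are found by
-- filtering a finite list of candidates; `∈-crossings` and
-- `crossings-unique` state that nothing is missed or counted twice.

module _ {A : Set} where

  lists≤ : List A → ℕ → List (List A)
  lists≤ as zero    = [] ∷ []
  lists≤ as (suc n) = [] ∷ cartesianProductWith _∷_ as (lists≤ as n)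

  candidates : List A → List (List⁺ A)
  candidates as = cartesianProductWith _∷_ as (lists≤ as (length as))

rectangle : (l w : ℕ) → List Point
rectangle l w = cartesianProductWith (λ i j → (+ i , + j)) (upTo l) (upTo w)

crossings : PathType → (l w : ℕ) → List (List⁺ Point)
crossings t l w = filter (isCrossing? t l w) (candidates (rectangle l w))

𝓑 : PathType → (l w : ℕ) → ℕ
𝓑 t l w = length (crossings t l w)

module _ {A : Set} where

  private
    ∈-remove : ∀ {x y : A} as {bs} → ¬ x ≡ y → y ∈ as ++ x ∷ bs → y ∈ as ++ bs
    ∈-remove as x≢y y∈ with ∈-++⁻ as y∈
    ... | inj₁ y∈as         = ∈-++⁺ˡ y∈as
    ... | inj₂ (here y≡x)   = ⊥-elim (x≢y (sym y≡x))
    ... | inj₂ (there y∈bs) = ∈-++⁺ʳ as y∈bs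

  Unique⇒length≤ : ∀ {xs ys : List A} → Unique xs → All (_∈ ys) xs →
                   length xs ℕ.≤ length ys
  Unique⇒length≤ [] [] = z≤n
  Unique⇒length≤ {x ∷ xs} (x∉xs ∷ xs!) (x∈ys ∷ xs⊆ys) with ∈-∃++ x∈ys
  ... | as , bs , refl = begin
    suc (length xs)                ≤⟨ s≤s (Unique⇒length≤ xs! (All.zipWith (λ (x≢y , y∈) → ∈-remove as x≢y y∈) (x∉xs , xs⊆ys))) ⟩
    suc (length (as ++ bs))        ≡⟨ cong suc (length-++ as) ⟩
    suc (length as ℕ.+ length bs)  ≡⟨ ℕ.+-suc (length as) (length bs) ⟨
    length as ℕ.+ suc (length bs)  ≡⟨ length-++ as ⟨
    length (as ++ x ∷ bs)          ∎
    where open ℕ.≤-Reasoning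

  ∈-lists≤ : ∀ {as xs : List A} {n} → All (_∈ as) xs → length xs ℕ.≤ n → xs ∈ lists≤ as n
  ∈-lists≤ {n = zero}  []          _           = here refl
  ∈-lists≤ {n = suc n} []          _           = here refl
  ∈-lists≤ {n = suc n} (x∈ ∷ xs⊆) (s≤s len≤n) =
    there (∈-cartesianProductWith⁺ _∷_ x∈ (∈-lists≤ xs⊆ len≤n))

  ∈-candidates : ∀ {as : List A} {xs : List⁺ A} → Unique (toList xs) →
                 All (_∈ as) (toList xs) → xs ∈ candidates as
  ∈-candidates {xs = x ∷ xs} xs!@(_ ∷ xs!′) (x∈ ∷ xs⊆) =
    ∈-cartesianProductWith⁺ _∷_ x∈ (∈-lists≤ xs⊆ (Unique⇒length≤ xs!′ xs⊆))

  lists≤-unique : ∀ {as : List A} → Unique as → ∀ n → Unique (lists≤ as n)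
  lists≤-unique as! zero    = [] ∷ []
  lists≤-unique {as} as! (suc n) =
      All.tabulate []∉
    ∷ Unique.cartesianProductWith⁺ _∷_ ∷-injective as! (lists≤-unique as! n)
    where
    []∉ : ∀ {ys} → ys ∈ cartesianProductWith _∷_ as (lists≤ as n) → ¬ [] ≡ ys
    []∉ ys∈ refl with ∈-cartesianProductWith⁻ _∷_ as (lists≤ as n) ys∈
    ... | _ , _ , _ , _ , ()

  candidates-unique : ∀ {as : List A} → Unique as → Unique (candidates as)
  candidates-unique as! =
    Unique.cartesianProductWith⁺ _∷_ (λ { refl → refl , refl }) as! (lists≤-unique as! _)

private
  below : ∀ l {n} → + n ℤ.≤ + l ℤ.- 1ℤ → n ∈ upTo l
  below (suc l) n≤ = ∈-upTo⁺ (s≤s (ℤ.drop‿+≤+ n≤))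

∈-rectangle : ∀ l w {p} → InRectangle l w p → p ∈ rectangle l w
∈-rectangle l w {+ a , + b} ((_ , a≤) , (_ , b≤)) =
  ∈-cartesianProductWith⁺ (λ i j → (+ i , + j)) (below l a≤) (below w b≤)

rectangle-unique : ∀ l w → Unique (rectangle l w)
rectangle-unique l w =
  Unique.cartesianProductWith⁺ _ (λ { refl → refl , refl }) (Unique.upTo⁺ l) (Unique.upTo⁺ w)

∈-crossings : ∀ t l w {ps} → (ps ∈ crossings t l w) ⇔ IsCrossing t l w ps
∈-crossings t l w = mk⇔
  (proj₂ ∘ ∈-filter⁻ (isCrossing? t l w) {xs = candidates (rectangle l w)})
  (λ c@((_ , ps!) , inside , _) →
    ∈-filter⁺ (isCrossing? t l w) (∈-candidates ps! (All.map (∈-rectangle l w) inside)) c)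

crossings-unique : ∀ t l w → Unique (crossings t l w)
crossings-unique t l w =
  Unique.filter⁺ (isCrossing? t l w) (candidates-unique (rectangle-unique l w))

------------------------------------------------------------------------
-- Formal power series with integer coefficients; equality of series is _≗_

Series : Set
Series = ℕ → ℤ

infixl 8 _z^_
infixl 7 _⊛_ _⊘_
infixl 6 _⊕_ _⊖_

_z^_ : ℤ → ℕ → Series
(c z^ k) n = if n ℕ.≡ᵇ k then c else 0ℤ

_⊕_ _⊖_ : Series → Series → Series
(f ⊕ g) n = f n ℤ.+ g n
(f ⊖ g) n = f n ℤ.- g n

-- Cauchy product: (f ⊛ g) n = f 0 * g n + f 1 * g (n - 1) + … + f n * g 0
_⊛_ : Series → Series → Series
(f ⊛ g) zero    = f 0 ℤ.* g 0
(f ⊛ g) (suc n) = f 0 ℤ.* g (suc n) ℤ.+ ((f ∘ suc) ⊛ g) n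

-- Quotient of f by a series g with constant term 1 (meaningful only then),
-- by long division: f = f₀ g + z r gives f / g = f₀ + z (r / g).
_⊘_ : Series → Series → Series
(f ⊘ g) zero    = f 0
(f ⊘ g) (suc n) = ((λ k → f (suc k) ℤ.- f 0 ℤ.* g (suc k)) ⊘ g) n

⊘-⊛ : ∀ f {g} → g 0 ≡ 1ℤ → (f ⊘ g) ⊛ g ≗ f
⊘-⊛ f g₀≡1 zero = trans (cong (f 0 ℤ.*_) g₀≡1) (ℤ.*-identityʳ (f 0))
⊘-⊛ f {g} g₀≡1 (suc n) =
  trans (cong (λ x → f 0 ℤ.* g (suc n) ℤ.+ x) (⊘-⊛ _ g₀≡1 n))
        (cancel (f 0 ℤ.* g (suc n)) (f (suc n)))
  where
  cancel : ∀ x y → x ℤ.+ (y ℤ.- x) ≡ y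
  cancel = solve-∀

-- ∑_{l ≥ 1} a l z^l
∑₁ : (ℕ → ℕ) → Series
∑₁ a zero      = 0ℤ
∑₁ a l@(suc _) = + a l

-- The end of a vertical step has the opposite parity, so a second vertical step
-- right after it would lead back. A crossing is therefore a sequence of
-- horizontal steps with at most one vertical step in each column, and the
-- vertical edges of a column form a matching. For w = 4 the matching is
-- {0,1},{2,3} in columns of one parity and {1,2} in the others. Let n₀ … n₃
-- count the continuations from the four points of a column that do not begin
-- vertically. Passing through a column of the first kind turns them into
-- (n₀+n₁, n₀+n₁, n₂+n₃, n₂+n₃), of the second kind into (n₀, n₁+n₂, n₁+n₂, n₃);
-- hence (g,g,g,g) ↦ (g,2g,2g,g) ↦ (3g,3g,3g,3g).

module Submission where

open import Defs
open import Data.Bool.Base using (Bool; true; false; not; if_then_else_)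
open import Data.Bool.Properties using (not-involutive)
open import Data.Integer.Base as ℤ using (ℤ; +_; -[1+_]; 0ℤ; 1ℤ; ∣_∣)
import Data.Integer.Properties as ℤ
open import Data.Integer.Tactic.RingSolver using (solve-∀)
open import Data.List.Base using (List; []; _∷_; _++_; map; concatMap; length; upTo; initLast; _∷ʳ′_)
open import Data.List.Membership.Propositional using (_∈_; lose)
open import Data.List.Membership.Propositional.Properties
  using (∈-map⁺; ∈-map⁻; ∈-++⁺ˡ; ∈-++⁺ʳ; ∈-++⁻; ∈-upTo⁺; ∈-upTo⁻; ∈-concatMap⁺)
open import Data.List.NonEmpty.Base using (List⁺; _∷_; last)
open import Data.List.Properties using (length-++; length-map; ∷-injectiveʳ)
open import Data.List.Relation.Binary.Disjoint.Propositional using (Disjoint)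
open import Data.List.Relation.Unary.All as All using (All; []; _∷_)
open import Data.List.Relation.Unary.AllPairs using ([]; _∷_)
open import Data.List.Relation.Unary.Any using (here; there)
open import Data.List.Relation.Unary.Linked as Linked using (Linked; [-]; _∷_)
open import Data.List.Relation.Unary.Unique.Propositional using (Unique)
import Data.List.Relation.Unary.Unique.Propositional.Properties as Unique
open import Data.Nat.Base as ℕ using (ℕ; zero; suc; z≤n)
open import Data.Nat.Divisibility using (_∣?_)
open import Data.Nat.ListAction using (sum)
import Data.Nat.Properties as ℕ
open import Data.Nat.Tactic.RingSolver using () renaming (solve-∀ to solveℕ-∀)
open import Data.Product.Base using (∃; _×_; _,_; proj₁; proj₂)
open import Data.Sum.Base using (_⊎_; inj₁; inj₂)
open import Function.Base using (_∘_)
open import Function.Bundles using (_⇔_; mk⇔; Equivalence)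
open import Relation.Binary.PropositionalEquality
open import Relation.Nullary using (Dec; yes; no; does; contradiction; _×-dec_)
open import Relation.Nullary.Decidable using (dec-true; dec-false)
open import Relation.Unary using (Pred)
open import Level using (0ℓ)

-- Duplicate-free enumerations

last-∷ : ∀ {A : Set} {x y : A} zs → last (x ∷ y ∷ zs) ≡ last (y ∷ zs)
last-∷ zs with initLast zs
... | []      = refl
... | _ ∷ʳ′ _ = refl

-- Lets the filtered list `crossings` be traded for an enumeration built by recursion on the number
-- of columns, whose length obeys a recurrence.
length-unique : ∀ {A : Set} {xs ys : List A} → Unique xs → Unique ys →
                (∀ {z} → z ∈ xs ⇔ z ∈ ys) → length xs ≡ length ys
length-unique xs! ys! same = ℕ.≤-antisym
  (Unique⇒length≤ xs! (All.tabulate (Equivalence.to same)))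
  (Unique⇒length≤ ys! (All.tabulate (Equivalence.from same)))

module _ {A P : Set} where

  when : Dec P → List A → List A
  when P? xs = if does P? then xs else []

  ∈-when⁻ : ∀ (P? : Dec P) {x xs} → x ∈ when P? xs → P × x ∈ xs
  ∈-when⁻ (yes p) x∈ = p , x∈

  ∈-when⁺ : ∀ (P? : Dec P) {x xs} → P → x ∈ xs → x ∈ when P? xs
  ∈-when⁺ (yes _) _ x∈ = x∈
  ∈-when⁺ (no ¬p) p _  = contradiction p ¬p

  when-unique : ∀ (P? : Dec P) {xs} → Unique xs → Unique (when P? xs)
  when-unique (yes _) xs! = xs!
  when-unique (no _)  _   = []

  length-when : ∀ (P? : Dec P) xs → length (when P? xs) ≡ (if does P? then length xs else 0)
  length-when (yes _) xs = refl
  length-when (no _)  xs = refl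

module _ {A : Set} (f : A → List (List A)) where

  prepend : A → List (List⁺ A)
  prepend x = map (x ∷_) (f x)

  ∈-concatMap-prepend : ∀ xs {y ys} → ((y ∷ ys) ∈ concatMap prepend xs) ⇔ (y ∈ xs × ys ∈ f y)
  ∈-concatMap-prepend xs = mk⇔ (to xs) (λ (y∈ , ys∈) → ∈-concatMap⁺ prepend (lose y∈ (∈-map⁺ (_ ∷_) ys∈)))
    where
    to : ∀ xs {y ys} → (y ∷ ys) ∈ concatMap prepend xs → y ∈ xs × ys ∈ f y
    to (x ∷ xs) y∷ys∈ with ∈-++⁻ (prepend x) y∷ys∈
    ... | inj₂ y∷ys∈′ = let y∈ , ys∈ = to xs y∷ys∈′ in there y∈ , ys∈
    ... | inj₁ y∷ys∈′ with ∈-map⁻ (x ∷_) y∷ys∈′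
    ...   | _ , ys∈ , refl = here refl , ys∈

  concatMap-prepend-unique : (∀ x → Unique (f x)) → ∀ {xs} → Unique xs → Unique (concatMap prepend xs)
  concatMap-prepend-unique f! []             = []
  concatMap-prepend-unique f! {x ∷ xs} (x∉xs ∷ xs!) =
    Unique.++⁺ (Unique.map⁺ (λ { refl → refl }) (f! x)) (concatMap-prepend-unique f! xs!) disjoint
    where
    disjoint : Disjoint (prepend x) (concatMap prepend xs)
    disjoint (z∈₁ , z∈₂) with ∈-map⁻ (x ∷_) z∈₁
    ... | _ , _ , refl = All.lookup x∉xs (proj₁ (Equivalence.to (∈-concatMap-prepend xs) z∈₂)) refl

  length-concatMap-prepend : ∀ xs → length (concatMap prepend xs) ≡ sum (map (length ∘ f) xs)
  length-concatMap-prepend []       = refl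
  length-concatMap-prepend (x ∷ xs) =
    trans (length-++ (prepend x)) (cong₂ ℕ._+_ (length-map _ (f x)) (length-concatMap-prepend xs))

-- Steps

right up down : Point → Point
right (a , b) = (ℤ.suc a , b)
up    (a , b) = (a , ℤ.suc b)
down  (a , b) = (a , ℤ.pred b)

-- One Boolean absorbs the difference between the two path types, so the counting can be uniform in
-- `t`.
rises : PathType → Point → Bool
rises first  p = does (even? p)
rises second p = not (does (even? p))

-- The only point that a vertical step from p can lead to.
partner : PathType → Point → Point
partner t p = if rises t p then up p else down p

+ᴾ-right : ∀ p → p +ᴾ (1ℤ , 0ℤ) ≡ right p
+ᴾ-right (a , b) = cong₂ _,_ (ℤ.+-comm a 1ℤ) (ℤ.+-identityʳ b)

+ᴾ-up : ∀ p → p +ᴾ (0ℤ , 1ℤ) ≡ up p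
+ᴾ-up (a , b) = cong₂ _,_ (ℤ.+-identityʳ a) (ℤ.+-comm b 1ℤ)

+ᴾ-down : ∀ p → p +ᴾ (0ℤ , ℤ.-1ℤ) ≡ down p
+ᴾ-down (a , b) = cong₂ _,_ (ℤ.+-identityʳ a) (ℤ.+-comm b ℤ.-1ℤ)

step⇒ : ∀ t {p q} → Step t p q → q ≡ right p ⊎ q ≡ partner t p
step⇒ first  {p} (inj₁ refl) = inj₁ (+ᴾ-right p)
step⇒ second {p} (inj₁ refl) = inj₁ (+ᴾ-right p)
step⇒ first  {p} (inj₂ (inj₁ (even , refl))) rewrite dec-true  (even? p) even = inj₂ (+ᴾ-up p)
step⇒ first  {p} (inj₂ (inj₂ (odd  , refl))) rewrite dec-false (even? p) odd  = inj₂ (+ᴾ-down p)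
step⇒ second {p} (inj₂ (inj₁ (odd  , refl))) rewrite dec-false (even? p) odd  = inj₂ (+ᴾ-up p)
step⇒ second {p} (inj₂ (inj₂ (even , refl))) rewrite dec-true  (even? p) even = inj₂ (+ᴾ-down p)

right-step : ∀ t p → Step t p (right p)
right-step first  p = inj₁ (sym (+ᴾ-right p))
right-step second p = inj₁ (sym (+ᴾ-right p))

partner-step : ∀ t p → Step t p (partner t p)
partner-step first  p with even? p
... | yes even rewrite dec-true  (even? p) even = inj₂ (inj₁ (even , sym (+ᴾ-up p)))
... | no  odd  rewrite dec-false (even? p) odd  = inj₂ (inj₂ (odd  , sym (+ᴾ-down p)))
partner-step second p with even? p
... | yes even rewrite dec-true  (even? p) even = inj₂ (inj₂ (even , sym (+ᴾ-down p)))
... | no  odd  rewrite dec-false (even? p) odd  = inj₂ (inj₁ (odd  , sym (+ᴾ-up p)))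

-- Parity along steps and the matching of the vertical edges

even-suc : ∀ n → does (2 ∣? suc n) ≡ not (does (2 ∣? n))
even-suc 0             = refl
even-suc 1             = refl
even-suc (suc (suc n)) = even-suc n

∣suc-[1+n]∣ : ∀ n → ∣ ℤ.suc -[1+ n ] ∣ ≡ n
∣suc-[1+n]∣ zero    = refl
∣suc-[1+n]∣ (suc n) = refl

-- For negative `i` the absolute value falls instead of growing. A change by one flips the parity
-- either way.
even-+∣suc∣ : ∀ m i → does (2 ∣? (m ℕ.+ ∣ ℤ.suc i ∣)) ≡ not (does (2 ∣? (m ℕ.+ ∣ i ∣)))
even-+∣suc∣ m (+ n) rewrite ℕ.+-suc m n = even-suc (m ℕ.+ n)
even-+∣suc∣ m -[1+ n ] rewrite ℕ.+-suc m n | even-suc (m ℕ.+ n) | ∣suc-[1+n]∣ n = sym (not-involutive _)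

rises-up : ∀ t p → rises t (up p) ≡ not (rises t p)
rises-up first  (a , b) = even-+∣suc∣ ∣ a ∣ b
rises-up second (a , b) = cong not (even-+∣suc∣ ∣ a ∣ b)

rises-right : ∀ t p → rises t (right p) ≡ not (rises t p)
rises-right first (a , b) rewrite ℕ.+-comm ∣ ℤ.suc a ∣ ∣ b ∣ | ℕ.+-comm ∣ a ∣ ∣ b ∣ = even-+∣suc∣ ∣ b ∣ a
rises-right second p = cong not (rises-right first p)

rises-down : ∀ t p → rises t (down p) ≡ not (rises t p)
rises-down t (a , b) = begin
  rises t (down (a , b))              ≡⟨ not-involutive _ ⟨
  not (not (rises t (down (a , b))))  ≡⟨ cong not (rises-up t (down (a , b))) ⟨
  not (rises t (up (down (a , b))))   ≡⟨ cong (λ i → not (rises t (a , i))) (ℤ.suc-pred b) ⟩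
  not (rises t (a , b))               ∎
  where open ≡-Reasoning

-- A vertical step flips the parity, hence the direction of the next vertical step.
partner-involutive : ∀ t p → partner t (partner t p) ≡ p
partner-involutive t p with rises t p in eq
... | true  rewrite rises-up t p | eq = cong (proj₁ p ,_) (ℤ.pred-suc (proj₂ p))
... | false rewrite rises-down t p | eq = cong (proj₁ p ,_) (ℤ.suc-pred (proj₂ p))

partner-column : ∀ t p → proj₁ (partner t p) ≡ proj₁ p
partner-column t p with rises t p
... | true  = refl
... | false = refl

partner-distinct : ∀ t p → p ≢ partner t p
partner-distinct t p p≡ with rises t p
... | true  = ℤ.i≢suc[i] (cong proj₂ p≡)
... | false = ℤ.i≢suc[i] (trans (cong proj₂ (sym p≡)) (sym (ℤ.suc-pred (proj₂ p))))

i<suc[i] : ∀ i → i ℤ.< ℤ.suc i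
i<suc[i] i = ℤ.suc[i]≤j⇒i<j ℤ.≤-refl

partner≢right : ∀ t p → partner t p ≢ right p
partner≢right t p eq = ℤ.i≢suc[i] (trans (sym (partner-column t p)) (cong proj₁ eq))

+-suc-shift : ∀ k i → + k ℤ.+ ℤ.suc i ≡ + suc k ℤ.+ i
+-suc-shift k i = shift (+ k) i
  where
  shift : ∀ j i → j ℤ.+ (1ℤ ℤ.+ i) ≡ (1ℤ ℤ.+ j) ℤ.+ i
  shift = solve-∀

-- Enumeration of the crossings

module _ (t : PathType) (w : ℕ) where

  Row : Pred Point 0ℓ
  Row (_ , b) = 0ℤ ℤ.≤ b × b ℤ.≤ + w ℤ.- 1ℤ

  row? : ∀ p → Dec (Row p)
  row? (_ , b) = (0ℤ ℤ.≤? b) ×-dec (b ℤ.≤? + w ℤ.- 1ℤ)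

  -- The continuations of a path from its point p to the column k places
  -- further right: those that do not begin with a vertical step, those that
  -- do (given the former for the partner of p), and all of them.
  onward  : ℕ → Point → List (List Point)
  detour  : (Point → List (List Point)) → Point → List (List Point)
  through : ℕ → Point → List (List Point)
  onward zero    p = [] ∷ []
  onward (suc k) p = map (right p ∷_) (through k (right p))
  detour f p = when (row? (partner t p)) (map (partner t p ∷_) (f (partner t p)))
  through k p = onward k p ++ detour (onward k) p

  module _ (f : Point → List (List Point)) (p : Point) where

    ∈-detour⁻ : ∀ {ps} → ps ∈ detour f p →
                Row (partner t p) × ∃ λ qs → qs ∈ f (partner t p) × ps ≡ partner t p ∷ qs
    ∈-detour⁻ ps∈ =
      let row , ps∈′ = ∈-when⁻ (row? (partner t p)) ps∈
      in row , ∈-map⁻ (partner t p ∷_) ps∈′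

    ∈-detour⁺ : ∀ {qs} → Row (partner t p) → qs ∈ f (partner t p) → partner t p ∷ qs ∈ detour f p
    ∈-detour⁺ row qs∈ = ∈-when⁺ (row? (partner t p)) row (∈-map⁺ (partner t p ∷_) qs∈)

    detour-unique : Unique (f (partner t p)) → Unique (detour f p)
    detour-unique f! = when-unique (row? (partner t p)) (Unique.map⁺ ∷-injectiveʳ f!)

    length-detour : length (detour f p) ≡
      (if does (row? (partner t p)) then length (f (partner t p)) else 0)
    length-detour = trans (length-when (row? (partner t p)) _)
      (cong (λ n → if does (row? (partner t p)) then n else 0) (length-map _ (f (partner t p))))

  onward-begins : ∀ k {p q ps} → q ∷ ps ∈ onward k p → q ≡ right p
  onward-begins zero    (here ())
  onward-begins zero    (there ())
  onward-begins (suc k) {p} q∷ps∈ with ∈-map⁻ (right p ∷_) q∷ps∈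
  ... | _ , _ , refl = refl

  onward-unique  : ∀ k p → Unique (onward k p)
  through-unique : ∀ k p → Unique (through k p)
  onward-unique zero    p = [] ∷ []
  onward-unique (suc k) p = Unique.map⁺ ∷-injectiveʳ (through-unique k (right p))
  through-unique k p =
    Unique.++⁺ (onward-unique k p) (detour-unique (onward k) p (onward-unique k (partner t p))) disjoint
    where
    disjoint : Disjoint (onward k p) (detour (onward k) p)
    disjoint (ps∈₁ , ps∈₂) with ∈-detour⁻ (onward k) p ps∈₂
    ... | _ , _ , _ , refl = partner≢right t p (onward-begins k ps∈₁)

  -- The strict bound supplies the absence of repeated points: only a point and its partner share a
  -- column, and `partner-distinct` separates these. For a start in column 0 it also yields
  -- `NotAlongLeftSide`.
  onward-columns  : ∀ k {p ps} → ps ∈ onward k p → All (λ q → proj₁ p ℤ.< proj₁ q) ps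
  through-columns : ∀ k {p ps} → ps ∈ through k p → All (λ q → proj₁ p ℤ.≤ proj₁ q) ps
  onward-columns zero (here refl) = []
  onward-columns (suc k) {p} ps∈ with ∈-map⁻ (right p ∷_) ps∈
  ... | _ , qs∈ , refl =
    i<suc[i] _ ∷ All.map (ℤ.<-≤-trans (i<suc[i] _)) (through-columns k {right p} qs∈)
  through-columns k {p} ps∈ with ∈-++⁻ (onward k p) ps∈
  ... | inj₁ ps∈₁ = All.map ℤ.<⇒≤ (onward-columns k ps∈₁)
  ... | inj₂ ps∈₂ with ∈-detour⁻ (onward k) p ps∈₂
  ...   | _ , _ , qs∈ , refl =
    ℤ.≤-reflexive p≡ ∷ All.map (ℤ.≤-trans (ℤ.≤-reflexive p≡) ∘ ℤ.<⇒≤) (onward-columns k {partner t p} qs∈)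
    where p≡ = sym (partner-column t p)

  -- The transfer rule of the count. A partner outside the rows contributes 0, and `detour` resumes
  -- with `onward`, so no column receives a second vertical step.
  length-onward-suc : ∀ k p → length (onward (suc k) p) ≡
    length (onward k (right p)) ℕ.+
    (if does (row? (partner t (right p))) then length (onward k (partner t (right p))) else 0)
  length-onward-suc k p = begin
    length (onward (suc k) p)    ≡⟨ length-map _ (through k (right p)) ⟩
    length (through k (right p)) ≡⟨ length-++ (onward k (right p)) ⟩
    length (onward k (right p)) ℕ.+ length (detour (onward k) (right p))
      ≡⟨ cong (length (onward k (right p)) ℕ.+_) (length-detour (onward k) (right p)) ⟩
    _ ∎
    where open ≡-Reasoning

  leftSide : List Point
  leftSide = map (λ j → (0ℤ , + j)) (upTo w)

  -- Built from `onward` rather than `through`, since vertical steps are forbidden on the left side.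
  -- Here `k` is `l - 1`.
  allCrossings : ℕ → List (List⁺ Point)
  allCrossings k = concatMap (prepend (onward k)) leftSide

  -- Soundness and completeness of the enumeration

  module _ (l : ℕ) where

    -- `IsCrossing` without its conditions at the left side; unlike the condition on the starting
    -- point, what is left passes to the rest of a path.
    Continues : Point → List Point → Set
    Continues p ps = IsBrickWallPath t (p ∷ ps) × All (InRectangle l w) (p ∷ ps)
                   × proj₁ (last (p ∷ ps)) ≡ + l ℤ.- 1ℤ

    continues-∷⁺ : ∀ {p q ps} → Step t p q → InRectangle l w p → All (p ≢_) (q ∷ ps) →
                   Continues q ps → Continues p (q ∷ ps)
    continues-∷⁺ {ps = ps} pq p-in p∉ ((steps , q∷ps!) , inside , end) =
      (pq ∷ steps , p∉ ∷ q∷ps!) , p-in ∷ inside , trans (cong proj₁ (last-∷ ps)) end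

    continues-∷⁻ : ∀ {p q ps} → Continues p (q ∷ ps) → Continues q ps
    continues-∷⁻ {ps = ps} ((_ ∷ steps , _ ∷ q∷ps!) , _ ∷ inside , end) =
      (steps , q∷ps!) , inside , trans (sym (cong proj₁ (last-∷ ps))) end

    inRectangle : ∀ k {p} → + k ℤ.+ proj₁ p ≡ + l ℤ.- 1ℤ → 0ℤ ℤ.≤ proj₁ p → Row p → InRectangle l w p
    inRectangle k {p} eq 0≤a row = (0≤a , subst (proj₁ p ℤ.≤_) eq (ℤ.i≤j+i (proj₁ p) (+ k))) , row

    -- The equation is the invariant of the induction: the right side is `k` columns away from `p`.
    -- A step right moves one unit from `k` to the column; a vertical step changes neither.
    onward-sound  : ∀ k {p ps} → + k ℤ.+ proj₁ p ≡ + l ℤ.- 1ℤ → 0ℤ ℤ.≤ proj₁ p → Row p →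
                    ps ∈ onward k p → Continues p ps
    through-sound : ∀ k {p ps} → + k ℤ.+ proj₁ p ≡ + l ℤ.- 1ℤ → 0ℤ ℤ.≤ proj₁ p → Row p →
                    ps ∈ through k p → Continues p ps
    onward-sound zero {p} eq 0≤a row (here refl) =
      ([-] , [] ∷ []) , inRectangle 0 eq 0≤a row ∷ [] , trans (sym (ℤ.+-identityˡ (proj₁ p))) eq
    onward-sound (suc k) {p} eq 0≤a row ps∈ with ∈-map⁻ (right p ∷_) ps∈
    ... | _ , qs∈ , refl = continues-∷⁺ (right-step t p) (inRectangle (suc k) eq 0≤a row)
      (All.map (λ { a<a refl → ℤ.<-irrefl refl a<a }) (onward-columns (suc k) ps∈))
      (through-sound k (trans (+-suc-shift k (proj₁ p)) eq) (ℤ.i≤j⇒i≤1+j 0≤a) row qs∈)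
    through-sound k {p} eq 0≤a row ps∈ with ∈-++⁻ (onward k p) ps∈
    ... | inj₁ ps∈₁ = onward-sound k eq 0≤a row ps∈₁
    ... | inj₂ ps∈₂ with ∈-detour⁻ (onward k) p ps∈₂
    ...   | row′ , _ , qs∈ , refl = continues-∷⁺ (partner-step t p) (inRectangle k eq 0≤a row)
      (partner-distinct t p ∷
        All.map (λ { a<a refl → ℤ.<-irrefl (partner-column t p) a<a }) (onward-columns k {partner t p} qs∈))
      (onward-sound k (trans (cong (λ i → + k ℤ.+ i) p≡) eq) (subst (0ℤ ℤ.≤_) (sym p≡) 0≤a) row′ qs∈)
      where p≡ = partner-column t p

    -- A vertical beginning is excluded for one of three reasons: the path starts on the left side,
    -- it has just made a vertical step and would return to a visited point, or its next step is
    -- known to go right.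
    onward-complete  : ∀ k {p ps} → + k ℤ.+ proj₁ p ≡ + l ℤ.- 1ℤ → (∀ qs → ps ≢ partner t p ∷ qs) →
                       Continues p ps → ps ∈ onward k p
    through-complete : ∀ k {p ps} → + k ℤ.+ proj₁ p ≡ + l ℤ.- 1ℤ → Continues p ps → ps ∈ through k p
    onward-complete k {p} {q ∷ qs} eq horizontal ((pq ∷ _ , _) , _) with step⇒ t pq
    onward-complete k {p} {q ∷ qs} eq horizontal _ | inj₂ refl = contradiction refl (horizontal qs)
    -- With `k = 0` the point `p` is on the right side, so a step right would leave the rectangle.
    onward-complete zero {p} {q ∷ qs} eq horizontal (_ , _ ∷ ((_ , a≤) , _) ∷ _ , _) | inj₁ refl =
      contradiction (ℤ.≤-<-trans (subst (ℤ.suc (proj₁ p) ℤ.≤_) (trans (sym eq) (ℤ.+-identityˡ (proj₁ p))) a≤)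
                                  (i<suc[i] (proj₁ p)))
                    (ℤ.<-irrefl refl)
    onward-complete (suc k) {p} {q ∷ qs} eq horizontal c | inj₁ refl =
      ∈-map⁺ _ (through-complete k (trans (+-suc-shift k (proj₁ p)) eq) (continues-∷⁻ c))
    onward-complete zero {ps = []} eq horizontal c = here refl
    -- Stopping here would leave the path `suc k` columns short of the right side.
    onward-complete (suc k) {p} {[]} eq horizontal (_ , _ , end) = contradiction
      (subst (proj₁ p ℤ.<_) (trans (+-suc-shift k (proj₁ p)) (trans eq (sym end)))
        (ℤ.<-≤-trans (i<suc[i] (proj₁ p)) (ℤ.i≤j+i (ℤ.suc (proj₁ p)) (+ k))))
      (ℤ.<-irrefl refl)
    through-complete k {p} {[]} eq c = ∈-++⁺ˡ (onward-complete k eq (λ _ ()) c)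
    through-complete k {p} {q ∷ qs} eq c@((pq ∷ _ , (_ ∷ p∉) ∷ _) , _ ∷ (_ , row) ∷ _ , _) with step⇒ t pq
    ... | inj₁ refl = ∈-++⁺ˡ (onward-complete k eq (λ _ eq′ → partner≢right t p (sym (cong firstPoint eq′))) c)
      where
      firstPoint : List Point → Point
      firstPoint []      = p
      firstPoint (x ∷ _) = x
    ... | inj₂ refl = ∈-++⁺ʳ (onward k p) (∈-detour⁺ (onward k) p row
      (onward-complete k (trans (cong (λ i → + k ℤ.+ i) (partner-column t p)) eq)
        (λ { _ refl → All.head p∉ (sym (partner-involutive t p)) })
        (continues-∷⁻ c)))

  NotAlongLeftSide-linked : ∀ {p ps} → All (λ q → 0ℤ ℤ.< proj₁ q) ps → Linked NotAlongLeftSide (p ∷ ps)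
  NotAlongLeftSide-linked []          = [-]
  NotAlongLeftSide-linked (0<a ∷ 0<as) =
    (λ (_ , a≡0) → ℤ.<-irrefl (sym a≡0) 0<a) ∷ NotAlongLeftSide-linked 0<as

  ∈-leftSide⁺ : ∀ {b} → Row (0ℤ , b) → (0ℤ , b) ∈ leftSide
  ∈-leftSide⁺ {+ n} (_ , n≤) = ∈-map⁺ _ (below w n≤)
    where
    below : ∀ w → + n ℤ.≤ + w ℤ.- 1ℤ → n ∈ upTo w
    below (suc w) n≤ = ∈-upTo⁺ (ℕ.s≤s (ℤ.drop‿+≤+ n≤))

  ∈-leftSide⁻ : ∀ {p} → p ∈ leftSide → proj₁ p ≡ 0ℤ × Row p
  ∈-leftSide⁻ p∈ with ∈-map⁻ _ p∈
  ... | j , j∈ , refl = refl , ℤ.+≤+ z≤n , above w (∈-upTo⁻ j∈)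
    where
    above : ∀ w → j ℕ.< w → + j ℤ.≤ + w ℤ.- 1ℤ
    above (suc w) (ℕ.s≤s j≤w) = ℤ.+≤+ j≤w

  ∈-allCrossings : ∀ k {ps} → ps ∈ allCrossings k ⇔ IsCrossing t (suc k) w ps
  ∈-allCrossings k {p ∷ ps} = mk⇔ to from
    where
    to : (p ∷ ps) ∈ allCrossings k → IsCrossing t (suc k) w (p ∷ ps)
    to ps∈ with Equivalence.to (∈-concatMap-prepend (onward k) leftSide) ps∈
    ... | p∈ , ps∈′ with ∈-leftSide⁻ p∈
    -- The invariant holds at the start because the column is 0 and `+ suc k - 1` reduces to `+ k`.
    ...   | refl , row with onward-sound (suc k) k (ℤ.+-identityʳ (+ k)) ℤ.≤-refl row ps∈′
    ...     | path , inside , end =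
      path , inside , refl , end , NotAlongLeftSide-linked (onward-columns k ps∈′)
    from : IsCrossing t (suc k) w (p ∷ ps) → (p ∷ ps) ∈ allCrossings k
    from (path , inside@((_ , row) ∷ _) , refl , end , left) =
      Equivalence.from (∈-concatMap-prepend (onward k) leftSide)
        ( ∈-leftSide⁺ row
        , onward-complete (suc k) k (ℤ.+-identityʳ (+ k))
            (λ { _ refl → Linked.head left (refl , partner-column t p) })
            (path , inside , end))

  𝓑-sum : ∀ k → 𝓑 t (suc k) w ≡ sum (map (length ∘ onward k) leftSide)
  𝓑-sum k = trans
    (length-unique (crossings-unique t (suc k) w)
      (concatMap-prepend-unique (onward k) (onward-unique k) (Unique.map⁺ (λ { refl → refl }) (Unique.upTo⁺ w)))
      (mk⇔ (Equivalence.from (∈-allCrossings k) ∘ Equivalence.to (∈-crossings t (suc k) w))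
           (Equivalence.from (∈-crossings t (suc k) w) ∘ Equivalence.to (∈-allCrossings k))))
    (length-concatMap-prepend (onward k) leftSide)

-- Counting for w = 4

-- The common value `g` of the four counts when the next column has the matching {0,1},{2,3}: 1 with
-- no column left, 2 with one, and a factor 3 for every two further columns.
growth : ℕ → ℕ
growth 0             = 1
growth 1             = 2
growth (suc (suc k)) = 3 ℕ.* growth k

module _ (t : PathType) where

  count : ℕ → Point → ℕ
  count k p = length (onward t 4 k p)

  profile : ℕ → ℤ → List ℕ
  profile k a = count k (a , + 0) ∷ count k (a , + 1) ∷ count k (a , + 2) ∷ count k (a , + 3) ∷ []

  -- The vertical steps counted take place in column `suc a`, where the parity is opposite to that
  -- of `a`: row 0 rises there, so the matching is {0,1},{2,3}.
  profile-rising : ∀ k a {n₀ n₁ n₂ n₃} → rises t (a , + 0) ≡ false →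
    profile k (ℤ.suc a) ≡ n₀ ∷ n₁ ∷ n₂ ∷ n₃ ∷ [] →
    profile (suc k) a ≡ n₀ ℕ.+ n₁ ∷ n₁ ℕ.+ n₀ ∷ n₂ ℕ.+ n₃ ∷ n₃ ℕ.+ n₂ ∷ []
  profile-rising k a r refl
    -- The direction is known in row 0 only; `rises-up`, applied from the top row down, reduces the
    -- other rows to it. The row tests then evaluate.
    rewrite length-onward-suc t 4 k (a , + 0) | length-onward-suc t 4 k (a , + 1)
          | length-onward-suc t 4 k (a , + 2) | length-onward-suc t 4 k (a , + 3)
          | rises-up t (ℤ.suc a , + 2) | rises-up t (ℤ.suc a , + 1) | rises-up t (ℤ.suc a , + 0)
          | rises-right t (a , + 0) | r
    = refl

  -- Now column `suc a` has the matching {1,2}; the partners of rows 0 and 3 lie in rows -1 and 4,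
  -- outside the rectangle, whence the terms 0.
  profile-falling : ∀ k a {n₀ n₁ n₂ n₃} → rises t (a , + 0) ≡ true →
    profile k (ℤ.suc a) ≡ n₀ ∷ n₁ ∷ n₂ ∷ n₃ ∷ [] →
    profile (suc k) a ≡ n₀ ℕ.+ 0 ∷ n₁ ℕ.+ n₂ ∷ n₂ ℕ.+ n₁ ∷ n₃ ℕ.+ 0 ∷ []
  profile-falling k a r refl
    rewrite length-onward-suc t 4 k (a , + 0) | length-onward-suc t 4 k (a , + 1)
          | length-onward-suc t 4 k (a , + 2) | length-onward-suc t 4 k (a , + 3)
          | rises-up t (ℤ.suc a , + 2) | rises-up t (ℤ.suc a , + 1) | rises-up t (ℤ.suc a , + 0)
          | rises-right t (a , + 0) | r
    = refl

  -- Mutual induction: the parity alternates from column to column, so each claim at `a` rests on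
  -- the other at `suc a`.
  rising-profile : ∀ k a → rises t (a , + 0) ≡ false →
    profile k a ≡ growth k ∷ growth k ∷ growth k ∷ growth k ∷ []
  falling-profile : ∀ k a → rises t (a , + 0) ≡ true →
    profile (suc k) a ≡ growth k ∷ 2 ℕ.* growth k ∷ 2 ℕ.* growth k ∷ growth k ∷ []
  rising-profile 0 a _ = refl
  rising-profile 1 a r = profile-rising 0 a r refl
  rising-profile (suc (suc k)) a r = trans
    (profile-rising (suc k) a r
      (falling-profile k (ℤ.suc a) (trans (rises-right t (a , + 0)) (cong not r))))
    -- The outer entries `g + 2g` are `3g` by computation; the inner ones arrive as `2g + g`.
    (cong (λ x → growth (2 ℕ.+ k) ∷ x ∷ x ∷ growth (2 ℕ.+ k) ∷ []) (ℕ.+-comm (2 ℕ.* growth k) (growth k)))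
  falling-profile k a r = trans
    (profile-falling k a r
      (rising-profile k (ℤ.suc a) (trans (rises-right t (a , + 0)) (cong not r))))
    (cong₂ (λ x y → x ∷ y ∷ y ∷ x ∷ []) (ℕ.+-identityʳ (growth k))
      (cong (growth k ℕ.+_) (sym (ℕ.+-identityʳ (growth k)))))

  𝓑-rising : rises t (0ℤ , + 0) ≡ false → ∀ k → 𝓑 t (suc k) 4 ≡ 4 ℕ.* growth k
  𝓑-rising r k = trans (𝓑-sum t 4 k) (cong sum (rising-profile k 0ℤ r))

  -- Starts at `l = 2`, because the profile (g,2g,2g,g) presupposes a column to the right.
  𝓑-falling : rises t (0ℤ , + 0) ≡ true → ∀ k → 𝓑 t (suc (suc k)) 4 ≡ 6 ℕ.* growth k
  𝓑-falling r k = trans (𝓑-sum t 4 (suc k)) (trans (cong sum (falling-profile k 0ℤ r)) (total (growth k)))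
    where
    total : ∀ g → g ℕ.+ (2 ℕ.* g ℕ.+ (2 ℕ.* g ℕ.+ (g ℕ.+ 0))) ≡ 6 ℕ.* g
    total = solveℕ-∀

-- Generating functions

-- Follows the long division: as `g 0` is 1, the constant terms of `h` and `f` agree, and the tail
-- of `h` times `g` is the remainder that `⊘` divides next.
⊘-unique : ∀ {h f g : Series} → g 0 ≡ 1ℤ → h ⊛ g ≗ f → h ≗ f ⊘ g
⊘-unique {h} g₀≡1 hg≗f zero =
  trans (sym (ℤ.*-identityʳ (h 0))) (trans (cong (h 0 ℤ.*_) (sym g₀≡1)) (hg≗f 0))
⊘-unique {h} {f} {g} g₀≡1 hg≗f (suc n) = ⊘-unique g₀≡1 remainder n
  where
  open ≡-Reasoning
  cancel : ∀ x y → (x ℤ.+ y) ℤ.- x ≡ y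
  cancel = solve-∀
  remainder : (h ∘ suc) ⊛ g ≗ λ k → f (suc k) ℤ.- f 0 ℤ.* g (suc k)
  remainder k = begin
    ((h ∘ suc) ⊛ g) k                    ≡⟨ cancel (h 0 ℤ.* g (suc k)) _ ⟨
    (h ⊛ g) (suc k) ℤ.- h 0 ℤ.* g (suc k)
      ≡⟨ cong₂ (λ x y → x ℤ.- y ℤ.* g (suc k)) (hg≗f (suc k)) (⊘-unique {h} g₀≡1 hg≗f 0) ⟩
    f (suc k) ℤ.- f 0 ℤ.* g (suc k)      ∎

-- Leading coefficients of `h` meet zero coefficients of the binomial and are peeled off until three
-- terms remain.
⊛-binomial : ∀ h a n → (h ⊛ ((+ 1) z^ 0 ⊖ a z^ 2)) (suc (suc n)) ≡ h (suc (suc n)) ℤ.- a ℤ.* h n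
⊛-binomial h a zero = base (h 0) (h 1) (h 2) a
  where
  base : ∀ x y z a → x ℤ.* (0ℤ ℤ.- a) ℤ.+ (y ℤ.* (0ℤ ℤ.- 0ℤ) ℤ.+ z ℤ.* (1ℤ ℤ.- 0ℤ)) ≡ z ℤ.- a ℤ.* x
  base = solve-∀
⊛-binomial h a (suc n) =
  trans (cong₂ ℤ._+_ (ℤ.*-zeroʳ (h 0)) (⊛-binomial (h ∘ suc) a n)) (ℤ.+-identityˡ _)

series-from-recurrence : ∀ {b : ℕ → ℕ} {p q r} → b 1 ≡ p → b 2 ≡ q → (∀ n → b (3 ℕ.+ n) ≡ r ℕ.* b (suc n)) →
  ∑₁ b ≗ ((+ p) z^ 1 ⊕ (+ q) z^ 2) ⊘ ((+ 1) z^ 0 ⊖ (+ r) z^ 2)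
series-from-recurrence {b} {p} {q} {r} refl refl rec = ⊘-unique refl product
  where
  linear : ∀ x → 0ℤ ℤ.* 0ℤ ℤ.+ x ℤ.* 1ℤ ≡ x ℤ.+ 0ℤ
  linear = solve-∀
  quadratic : ∀ x y → y ℤ.- x ℤ.* 0ℤ ≡ 0ℤ ℤ.+ y
  quadratic = solve-∀
  product : ∑₁ b ⊛ ((+ 1) z^ 0 ⊖ (+ r) z^ 2) ≗ ((+ p) z^ 1 ⊕ (+ q) z^ 2)
  product 0 = refl
  product 1 = linear (+ p)
  -- The term in `r` vanishes because `∑₁ b` has constant coefficient 0.
  product 2 = trans (⊛-binomial (∑₁ b) (+ r) 0) (quadratic (+ r) (+ q))
  product (suc (suc (suc n))) = trans (⊛-binomial (∑₁ b) (+ r) (suc n))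
    (ℤ.i≡j⇒i-j≡0 (trans (cong +_ (rec n)) (ℤ.pos-* r (b (suc n)))))

*-3-swap : ∀ m g → m ℕ.* (3 ℕ.* g) ≡ 3 ℕ.* (m ℕ.* g)
*-3-swap = solveℕ-∀

growth-series : ∀ b → (∀ k → b (suc k) ≡ 4 ℕ.* growth k) →
  ∑₁ b ≗ ((+ 4) z^ 1 ⊕ (+ 8) z^ 2) ⊘ ((+ 1) z^ 0 ⊖ (+ 3) z^ 2)
growth-series b closed = series-from-recurrence (closed 0) (closed 1) λ n → begin
  b (3 ℕ.+ n)              ≡⟨ closed (2 ℕ.+ n) ⟩
  4 ℕ.* (3 ℕ.* growth n)   ≡⟨ *-3-swap 4 (growth n) ⟩
  3 ℕ.* (4 ℕ.* growth n)   ≡⟨ cong (3 ℕ.*_) (closed n) ⟨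
  3 ℕ.* b (suc n)          ∎
  where open ≡-Reasoning

growth-series-delayed : ∀ b → b 1 ≡ 4 → (∀ k → b (2 ℕ.+ k) ≡ 6 ℕ.* growth k) →
  ∑₁ b ≗ ((+ 4) z^ 1 ⊕ (+ 6) z^ 2) ⊘ ((+ 1) z^ 0 ⊖ (+ 3) z^ 2)
growth-series-delayed b b₁≡4 closed = series-from-recurrence b₁≡4 (closed 0) recurrence
  where
  open ≡-Reasoning
  recurrence : ∀ n → b (3 ℕ.+ n) ≡ 3 ℕ.* b (suc n)
  -- The value 4 of `b 1` is not an instance of `closed`, but the recurrence still holds there: 6 *
  -- 2 = 3 * 4.
  recurrence zero    = trans (closed 1) (cong (3 ℕ.*_) (sym b₁≡4))
  recurrence (suc n) = begin
    b (4 ℕ.+ n)              ≡⟨ closed (2 ℕ.+ n) ⟩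
    6 ℕ.* (3 ℕ.* growth n)   ≡⟨ *-3-swap 6 (growth n) ⟩
    3 ℕ.* (6 ℕ.* growth n)   ≡⟨ cong (3 ℕ.*_) (closed n) ⟨
    3 ℕ.* b (2 ℕ.+ n)        ∎

mainTheorem4 : (∑₁ (λ l → 𝓑 first  l 4) ≗ ((+ 4) z^ 1 ⊕ (+ 6) z^ 2) ⊘ ((+ 1) z^ 0 ⊖ (+ 3) z^ 2))
    × (∑₁ (λ l → 𝓑 second l 4) ≗ ((+ 4) z^ 1 ⊕ (+ 8) z^ 2) ⊘ ((+ 1) z^ 0 ⊖ (+ 3) z^ 2))
-- The origin is even, so it rises for `first` and falls for `second`. For `l = 1` the sum counts
-- four empty continuations.
mainTheorem4 = growth-series-delayed _ (𝓑-sum first 4 0) (𝓑-falling first refl)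
             , growth-series _ (𝓑-rising second refl)
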